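{- For every goal assignment $\gamma$ (of the language $\mathsf{TLCGA}$), the formulas $\langle\![\gamma]\!\rangle$ and $\mathsf{unfold}(\gamma)$ are semantically equivalent: $\langle\![\gamma]\!\rangle\equiv\mathsf{unfold}(\gamma)$. Hence, for every long-term temporal goal assignment $\gamma$, $\langle\![\gamma]\!\rangle\equiv\mathsf{ind}(\gamma,\langle\![\gamma]\!\rangle)$. (Here $\varphi\equiv\psi$ means that $\varphi$ and $\psi$ are true at exactly the same states of every concurrent game model.)
   Context: **Models.** Fix a finite set $\mathsf{Agt}$ of agents and a set $\mathsf{AP}$ of atomic propositions; a coalition is any subset of $\mathsf{Agt}$. A game form over an outcome set $O$ is $(\mathsf{Act},\mathsf{act},O,\mathsf{out})$ with $\mathsf{Act}\ne\emptyset$, $\mathsf{act}$ assigning to each agent $a$ a non-empty set $\mathsf{act}_a\subseteq\mathsf{Act}$, and $\mathsf{out}:\prod_{a\in\mathsf{Agt}}\mathsf{act}_a\to O$. A concurrent game model is $\mathcal M=(S,\mathsf{Act},\mathfrak g,V)$ with $S\neq\emptyset$ a set of states, $\mathfrak g$ assigning to each $w\in S$ a game form $(\mathsf{Act},\mathsf{act}_w,S,\mathsf{out}_w)$ over $S$, and $V:\mathsf{AP}\to\mathcal P(S)$. A history is a finite word $w_0\zeta_0w_1\cdots\zeta_{n-1}w_n$ ($n\ge 0$) with $w_i\in S$ and $\zeta_i\in\prod_a\mathsf{act}_{w_i}(a)$. A strategy for $a$ maps each history ending in $w$ to an element of $\mathsf{act}_w(a)$; a strategy profile $\Sigma$ assigns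 a strategy to each agent. The play induced by $\Sigma$ at $w$ is $w_0\zeta_0w_1\zeta_1\cdots$ with $w_0=w$, $\zeta_n=\Sigma(w_0\zeta_0\cdots w_n)$, $w_{n+1}=\mathsf{out}_{w_n}(\zeta_n)$; its path is $w_0w_1w_2\cdots$. $\mathsf{paths}(w,\Sigma,C)$ is the set of paths of plays induced at $w$ by strategy profiles $\Sigma'$ that agree with $\Sigma$ on all agents in $C$. **Language $\mathsf{TLCGA}$.** State formulas: $\varphi::=p\mid\top\mid\neg\varphi\mid(\varphi\wedge\varphi)\mid(\varphi\vee\varphi)\mid\langle\![\gamma]\!\rangle$; path formulas: $\theta::=\mathsf X\varphi\mid\varphi\,\mathsf U\,\varphi\mid\mathsf G\varphi$; here $p\in\mathsf{AP}$ and $\gamma$ is a goal assignment, i.e. a map from $\mathcal P(\mathsf{Agt})$ to path formulas. $\mathsf X\top$ is the trivial goal; the support of $\gamma$ is the set of coalitions $C$ with $\gamma(C)\neq\mathsf X\top$. If $\gamma$ has empty support, $\langle\![\gamma]\!\rangle$ is identified with $\top$. **Semantics.** Booleans as usual. For a path $\pi=w_0w_1\cdots$: $\pi\Vdash\mathsf X\varphi$ iff $\varphi$ is true at $w_1$; $\pi\Vdash\varphi\,\mathsf U\,\psi$ iff for some $i$, $\psi$ is true at $w_i$ and $\varphi$ at all $w_j$, $j<i$; $\pi\Vdash\mathsf G\varphi$ iff $\varphi$ is true at all $w_i$. $\mathcal M,s\Vdash\langle\![\gamma]\!\rangle$ iff there is a strategy profile $\Sigma$ such that for every $C\subseteq\mathsf{Agt}$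 and every $\pi\in\mathsf{paths}(s,\Sigma,C)$, $\pi\Vdash\gamma(C)$. **Notation on goal assignments.** $\gamma[C\triangleright\theta]$ is $\gamma$ modified to map $C$ to $\theta$; $\gamma\setminus C:=\gamma[C\triangleright\mathsf X\top]$; $\gamma|_C$ maps each $C'\subseteq C$ to $\gamma(C')$ and all other coalitions to $\mathsf X\top$; $\gamma|_{UG}$ agrees with $\gamma$ on coalitions whose goal is a $\mathsf U$- or $\mathsf G$-formula and maps all others to $\mathsf X\top$. $\gamma$ is long-term temporal if each coalition in its support is mapped to a $\mathsf U$- or $\mathsf G$-formula. **Unfolding.** Let $\gamma$ have support $\mathcal F$. The nexttime-extension $\Delta\gamma$ has support $\{\bigcup\mathcal F'\mid\emptyset\ne\mathcal F'\subseteq\mathcal F\}$, and for each $C$ in that set $$\Delta\gamma(C):=\mathsf X\Big(\bigwedge\{\varphi\mid \exists C'\in\mathcal F,\ C'\subseteq C,\ \gamma(C')=\mathsf X\varphi\}\wedge\langle\![(\gamma|_C)|_{UG}]\!\rangle\Big),$$ other coalitions getting the trivial goal. Put $\Delta\gamma\{\phi\}:=\Delta\gamma[\bigcup\mathcal F\triangleright\mathsf X\phi]$. Let $\mathsf{Finish}(\gamma)=\{\beta\wedge\langle\![\gamma\setminus C]\!\rangle\mid\gamma(C)=\alpha\,\mathsf U\,\beta\}$, $\mathsf{UHolds}(\gamma)=\{\alpha\mid\gamma(C)=\alpha\,\mathsf U\,\beta\text{ for some }C,\beta\}$, $\mathsf{GHolds}(\gamma)=\{\chi\mid\gamma(C)=\mathsf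 G\chi\text{ for some }C\}$. Then $$\mathsf{unfold}(\gamma):=\bigvee\mathsf{Finish}(\gamma)\vee\Big(\bigwedge\mathsf{UHolds}(\gamma)\wedge\bigwedge\mathsf{GHolds}(\gamma)\wedge\langle\![\Delta\gamma]\!\rangle\Big),$$ and for long-term temporal $\gamma$, $$\mathsf{ind}(\gamma,\phi):=\bigvee\mathsf{Finish}(\gamma)\vee\Big(\bigwedge\mathsf{UHolds}(\gamma)\wedge\bigwedge\mathsf{GHolds}(\gamma)\wedge\langle\![\Delta\gamma\{\phi\}]\!\rangle\Big).$$ Empty conjunctions ($\top$) and empty disjunctions ($\bot$) are removed where redundant. -}

module Defs where

open import Data.Bool.Base using (Bool; true; false; if_then_else_; not)
open import Data.Bool.ListAction using (all)
import Data.Bool.Properties as Bool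
open import Data.Fin.Base using (Fin)
open import Data.Fin.Subset using (Subset; inside; outside; _∈_; ⋃)
open import Data.Fin.Subset.Properties using (_⊆?_)
open import Data.List.Base using (List; []; _∷_; [_]; _++_; map; mapMaybe; filter; filterᵇ)
import Data.List.Membership.DecPropositional as DecMembership
import Data.List.Membership.Propositional as Membership
open import Data.Maybe.Base as Maybe using (Maybe; just; nothing)
open import Data.Nat.Base using (ℕ; zero; suc; _<_)
open import Data.Product.Base using (∃; _×_; _,_; proj₁)
open import Data.Refinement.Base using (Refinement-syntax)
open import Data.Sum.Base using (_⊎_)
open import Data.Unit.Base using (⊤)
open import Data.Vec.Base using ([]; _∷_)
open import Data.Vec.Properties using (≡-dec)
open import Function.Base using (_∘_)
open import Function.Bundles using (_⇔_)
open import Level using (0ℓ)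
open import Relation.Binary.Definitions using (DecidableEquality)
open import Relation.Binary.PropositionalEquality using (_≡_; _≗_)
open import Relation.Nullary.Decidable.Core using (does)
open import Relation.Nullary.Negation.Core using (¬_)
open import Relation.Unary using (Pred; Satisfiable)

------------------------------------------------------------------------
-- Agents and coalitions

Agent : ℕ → Set
Agent n = Fin n

Coalition : ℕ → Set
Coalition n = Subset n

_≟ᶜ_ : ∀ {n} → DecidableEquality (Coalition n)
_≟ᶜ_ = ≡-dec Bool._≟_

coalitions : ∀ n → List (Coalition n)
coalitions zero    = [ [] ]
coalitions (suc n) =
  map (inside ∷_) (coalitions n) ++ map (outside ∷_) (coalitions n)

------------------------------------------------------------------------
-- Concurrent game models

-- The action set of an agent is a subset of Act, given by a predicate whose
-- proofs are irrelevant: the elements of [ x ∈ Act ∣ act a x ] are actions,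
-- not actions together with a chosen proof.
record GameForm (n : ℕ) (Act O : Set) : Set₁ where
  field
    act          : Agent n → Pred Act 0ℓ
    act-nonempty : ∀ a → Satisfiable (act a)

  Action : Agent n → Set
  Action a = [ x ∈ Act ∣ act a x ]

  ActionProfile : Set
  ActionProfile = ∀ a → Action a

  field
    out : ActionProfile → O

record ConcurrentGameModel (n : ℕ) (AP : Set) : Set₁ where
  field
    State          : Set
    State-nonempty : State
    Act            : Set
    Act-nonempty   : Act
    𝔤              : State → GameForm n Act State
    V              : AP → Pred State 0ℓ

  module _ (w : State) where
    open GameForm (𝔤 w) public using (Action; ActionProfile; out)

  -- Indexed by the last state.  Successive states are not required to be
  -- related by out.
  data History : State → Set where
    ⟨_⟩   : ∀ w → History w
    _▹_,_ : ∀ {v} → History v → ActionProfile v → ∀ w → History w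

  Strategy : Agent n → Set
  Strategy a = ∀ {w} → History w → Action w a

  StrategyProfile : Set
  StrategyProfile = ∀ a → Strategy a

  actions : StrategyProfile → ∀ {w} → History w → ActionProfile w
  actions Σ h a = Σ a h

  step : StrategyProfile → ∃ History → ∃ History
  step Σ (v , h) = out v (actions Σ h) , (h ▹ actions Σ h , out v (actions Σ h))

  -- The prefix w₀ ζ₀ w₁ ⋯ ζᵢ₋₁ wᵢ of the play induced by Σ at w.
  play : StrategyProfile → State → ℕ → ∃ History
  play Σ w zero    = w , ⟨ w ⟩
  play Σ w (suc i) = step Σ (play Σ w i)

  Path : Set
  Path = ℕ → State

  inducedPath : StrategyProfile → State → Path
  inducedPath Σ w i = proj₁ (play Σ w i)

  AgreeOn : Coalition n → StrategyProfile → StrategyProfile → Set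
  AgreeOn C Σ′ Σ = ∀ a → a ∈ C → ∀ {w} (h : History w) → Σ′ a h ≡ Σ a h

  paths : State → StrategyProfile → Coalition n → Pred Path 0ℓ
  paths w Σ C π = ∃ λ Σ′ → AgreeOn C Σ′ Σ × π ≗ inducedPath Σ′ w

------------------------------------------------------------------------
-- Syntax

infix  9 ¬′_
infixr 8 _∧′_
infixr 7 _∨′_
infix  6 _U_

mutual
  data StateFormula (n : ℕ) (AP : Set) : Set where
    atom      : AP → StateFormula n AP
    ⊤′        : StateFormula n AP
    ¬′_       : StateFormula n AP → StateFormula n AP
    _∧′_ _∨′_ : StateFormula n AP → StateFormula n AP → StateFormula n AP
    ⟨[_]⟩     : (Coalition n → PathFormula n AP) → StateFormula n AP

  data PathFormula (n : ℕ) (AP : Set) : Set where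
    X   : StateFormula n AP → PathFormula n AP
    _U_ : StateFormula n AP → StateFormula n AP → PathFormula n AP
    G   : StateFormula n AP → PathFormula n AP

GoalAssignment : ℕ → Set → Set
GoalAssignment n AP = Coalition n → PathFormula n AP

-- Conjunctions and disjunctions of the finite sets of formulas below, which
-- are enumerated by lists (repetitions are harmless).  Redundant empty
-- conjunctions and disjunctions are removed by concatenating lists of
-- conjuncts (disjuncts) before forming the conjunction (disjunction).
⋀ : ∀ {n AP} → List (StateFormula n AP) → StateFormula n AP
⋀ []           = ⊤′
⋀ (φ ∷ [])     = φ
⋀ (φ ∷ ψ ∷ φs) = φ ∧′ ⋀ (ψ ∷ φs)

⋁ : ∀ {n AP} → List (StateFormula n AP) → StateFormula n AP
⋁ []           = ¬′ ⊤′
⋁ (φ ∷ [])     = φ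
⋁ (φ ∷ ψ ∷ φs) = φ ∨′ ⋁ (ψ ∷ φs)

------------------------------------------------------------------------
-- Semantics

module _ {n : ℕ} {AP : Set} (M : ConcurrentGameModel n AP) where
  open ConcurrentGameModel M

  mutual
    infix 4 _⊩_ _⊩ᵖ_

    _⊩_ : State → StateFormula n AP → Set
    s ⊩ atom p   = V p s
    s ⊩ ⊤′       = ⊤
    s ⊩ ¬′ φ     = ¬ (s ⊩ φ)
    s ⊩ φ ∧′ ψ   = (s ⊩ φ) × (s ⊩ ψ)
    s ⊩ φ ∨′ ψ   = (s ⊩ φ) ⊎ (s ⊩ ψ)
    s ⊩ ⟨[ γ ]⟩  = ∃ λ Σ → ∀ C π → paths s Σ C π → π ⊩ᵖ γ C

    _⊩ᵖ_ : Path → PathFormula n AP → Set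
    π ⊩ᵖ X φ   = π 1 ⊩ φ
    π ⊩ᵖ φ U ψ = ∃ λ i → (π i ⊩ ψ) × (∀ j → j < i → π j ⊩ φ)
    π ⊩ᵖ G φ   = ∀ i → π i ⊩ φ

infix 3 _≣_

_≣_ : ∀ {n AP} → StateFormula n AP → StateFormula n AP → Set₁
_≣_ {n} {AP} φ ψ = (M : ConcurrentGameModel n AP) →
  ∀ s → (_⊩_ M s φ) ⇔ (_⊩_ M s ψ)

------------------------------------------------------------------------
-- Goal assignments

-- ⟨[ γ ]⟩ is identified with ⊤′ when γ has empty support, so X ⟨[ γ ]⟩ is
-- then the trivial goal, too.
mutual
  is⊤ : ∀ {n AP} → StateFormula n AP → Bool
  is⊤     ⊤′      = true
  is⊤ {n} ⟨[ γ ]⟩ = all (λ C → isTrivial (γ C)) (coalitions n)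
  is⊤     _       = false

  isTrivial : ∀ {n AP} → PathFormula n AP → Bool
  isTrivial (X φ) = is⊤ φ
  isTrivial _     = false

data IsUG {n AP} : PathFormula n AP → Set where
  isU : ∀ {α β} → IsUG (α U β)
  isG : ∀ {χ} → IsUG (G χ)

nextArg untilLeft untilRight globallyArg :
  ∀ {n AP} → PathFormula n AP → Maybe (StateFormula n AP)

nextArg (X φ) = just φ
nextArg _     = nothing

untilLeft (α U β) = just α
untilLeft _       = nothing

untilRight (α U β) = just β
untilRight _       = nothing

globallyArg (G χ) = just χ
globallyArg _     = nothing

onlyUG : ∀ {n AP} → PathFormula n AP → PathFormula n AP
onlyUG (X φ)   = X ⊤′
onlyUG (α U β) = α U β
onlyUG (G χ)   = G χ

module _ {n : ℕ} {AP : Set} where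

  support : GoalAssignment n AP → List (Coalition n)
  support γ = filterᵇ (λ C → not (isTrivial (γ C))) (coalitions n)

  LongTermTemporal : GoalAssignment n AP → Set
  LongTermTemporal γ = ∀ C → C Membership.∈ support γ → IsUG (γ C)

  infixl 10 _[_▷_] _∖_ _∣_ _∣UG

  _[_▷_] : GoalAssignment n AP → Coalition n → PathFormula n AP →
           GoalAssignment n AP
  (γ [ C ▷ θ ]) C′ = if does (C′ ≟ᶜ C) then θ else γ C′

  _∖_ : GoalAssignment n AP → Coalition n → GoalAssignment n AP
  γ ∖ C = γ [ C ▷ X ⊤′ ]

  _∣_ : GoalAssignment n AP → Coalition n → GoalAssignment n AP
  (γ ∣ C) C′ = if does (C′ ⊆? C) then γ C′ else X ⊤′

  _∣UG : GoalAssignment n AP → GoalAssignment n AP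
  (γ ∣UG) C = onlyUG (γ C)

------------------------------------------------------------------------
-- Unfolding

nonemptySublists : ∀ {A : Set} → List A → List (List A)
nonemptySublists []       = []
nonemptySublists (x ∷ xs) =
  [ x ] ∷ map (x ∷_) (nonemptySublists xs) ++ nonemptySublists xs

module _ {n : ℕ} {AP : Set} where
  open DecMembership (_≟ᶜ_ {n}) using (_∈?_)

  ΔSupport : GoalAssignment n AP → List (Coalition n)
  ΔSupport γ = map ⋃ (nonemptySublists (support γ))

  Δ : GoalAssignment n AP → GoalAssignment n AP
  Δ γ C =
    if does (C ∈? ΔSupport γ)
    then X (⋀ (mapMaybe (nextArg ∘ γ) (filter (_⊆? C) (support γ))
               ++ [ ⟨[ γ ∣ C ∣UG ]⟩ ]))
    else X ⊤′

  Δ_⟨_⟩ : GoalAssignment n AP → StateFormula n AP → GoalAssignment n AP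
  Δ γ ⟨ φ ⟩ = Δ γ [ ⋃ (support γ) ▷ X φ ]

  Finish UHolds GHolds : GoalAssignment n AP → List (StateFormula n AP)
  Finish γ =
    mapMaybe (λ C → Maybe.map (_∧′ ⟨[ γ ∖ C ]⟩) (untilRight (γ C)))
             (coalitions n)
  UHolds γ = mapMaybe (untilLeft ∘ γ) (coalitions n)
  GHolds γ = mapMaybe (globallyArg ∘ γ) (coalitions n)

  unfold : GoalAssignment n AP → StateFormula n AP
  unfold γ =
    ⋁ (Finish γ ++ [ ⋀ (UHolds γ ++ GHolds γ ++ [ ⟨[ Δ γ ]⟩ ]) ])

  ind : GoalAssignment n AP → StateFormula n AP → StateFormula n AP
  ind γ φ =
    ⋁ (Finish γ ++ [ ⋀ (UHolds γ ++ GHolds γ ++ [ ⟨[ Δ γ ⟨ φ ⟩ ]⟩ ]) ])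

{-# OPTIONS --safe #-}

-- Let Σ enforce γ at s.  If the right-hand side of some U-goal holds at s, then
-- Σ enforces the remaining goals.  Otherwise every U- and G-goal passes to the
-- next state: after a first round ζ in which C follows Σ, the shifted profile
-- Σ(s ζ ⋯) enforces the U- and G-goals of the coalitions included in C, because
-- a play against it extends to a play against Σ.
--
-- Conversely, let Σ enforce Δγ at s.  After a first round ζ, let D be the union
-- of the coalitions in the support all of whose members followed Σ in ζ.  Then
-- D follows Σ, so the outcome of ζ admits a profile for (γ|_D)|_UG; play that
-- profile from then on.  A coalition C of the support that follows the composed
-- profile throughout is included in D, hence its goal is met.
--
-- For long-term temporal γ with union D of the support, Δγ(D) is equivalent to
-- X ⟨[ γ ]⟩, as (γ|_D)|_UG agrees with γ up to trivial goals.

module Submission where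

open import Defs
open import Axiom.ExcludedMiddle using (ExcludedMiddle)
open import Data.Nat.Base using (ℕ)
open import Data.Product.Base using (_×_)
open import Level using (0ℓ)
open import Data.Bool.Base using (T; true; false)
open import Data.Bool.Properties using (T?; T-not-≡)
open import Data.Fin.Subset using (inside; outside; ⋃; _∈_; _⊆_)
open import Data.Fin.Subset.Properties
  using (_⊆?_; p⊆p∪q; q⊆p∪q; x∈p∪q⁻; ∉⊥)
open import Data.List.Base
  using (List; []; _∷_; [_]; _++_; map; mapMaybe; filter)
import Data.List.Membership.DecPropositional as DecMembership
import Data.List.Membership.Propositional as Membership
open import Data.List.Membership.Propositional.Properties
  using (∈-map⁺; ∈-++⁺ˡ; ∈-++⁺ʳ; ∈-filter⁺; ∈-filter⁻)
open import Data.List.Relation.Binary.Sublist.Propositional as Sublist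
  using ([]; _∷_; _∷ʳ_)
open import Data.List.Relation.Binary.Sublist.Propositional.Properties
  using (filter-⊆)
open import Data.List.Relation.Unary.All as All using (All; []; _∷_)
import Data.List.Relation.Unary.All.Properties as All
open import Data.List.Relation.Unary.Any as Any using (Any; here; there)
import Data.List.Relation.Unary.Any.Properties as Any
open import Data.Maybe.Base as Maybe using (Maybe; just; nothing; maybe′)
open import Data.Maybe.Properties using (just-injective)
open import Data.Nat.Base using (zero; suc; z<s; s<s)
open import Data.Product.Base as Product using (∃; _,_; proj₁; proj₂)
import Data.Refinement.Base as Refinement
import Data.Irrelevant as Irrelevant
open import Data.Sum.Base as Sum using (_⊎_; inj₁; inj₂)
open import Data.Unit.Base using (tt)
open import Data.Vec.Base using ([]; _∷_)
open import Function.Base using (_∘_)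
open import Function.Bundles using (_⇔_; mk⇔; Equivalence)
open import Function.Construct.Composition using (_⇔-∘_)
open import Relation.Binary.PropositionalEquality
  using (_≡_; _≢_; _≗_; refl; sym; trans; cong; subst)
open import Relation.Nullary using (yes; no; does; ¬_; contradiction)
open import Relation.Nullary.Decidable using (dec-true; dec-false)

-- Finite lists and unions of coalitions

infix 4 _∈ˡ_
_∈ˡ_ : ∀ {A : Set} → A → List A → Set
_∈ˡ_ = Membership._∈_

module _ {A B : Set} (f : A → Maybe B) where

  ∈-mapMaybe⁺ : ∀ {x y xs} → x ∈ˡ xs → f x ≡ just y → y ∈ˡ mapMaybe f xs
  ∈-mapMaybe⁺ {xs = x ∷ _} (here refl) eq rewrite eq = here refl
  ∈-mapMaybe⁺ {xs = x ∷ _} (there p) eq with f x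
  ... | nothing = ∈-mapMaybe⁺ p eq
  ... | just _  = there (∈-mapMaybe⁺ p eq)

  ∈-mapMaybe⁻ : ∀ {y} xs → y ∈ˡ mapMaybe f xs →
                ∃ λ x → x ∈ˡ xs × f x ≡ just y
  ∈-mapMaybe⁻ (x ∷ xs) p with f x in eq
  ∈-mapMaybe⁻ (x ∷ xs) p           | nothing =
    let x′ , x′∈ , eq′ = ∈-mapMaybe⁻ xs p in x′ , there x′∈ , eq′
  ∈-mapMaybe⁻ (x ∷ xs) (here refl) | just _ = x , here refl , eq
  ∈-mapMaybe⁻ (x ∷ xs) (there p)   | just _ =
    let x′ , x′∈ , eq′ = ∈-mapMaybe⁻ xs p in x′ , there x′∈ , eq′

∈-nonemptySublists : ∀ {A : Set} {x : A} {xs ys} →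
  (x ∷ xs) Sublist.⊆ ys → (x ∷ xs) ∈ˡ nonemptySublists ys
∈-nonemptySublists {ys = y ∷ ys} (_ ∷ʳ p) =
  there (∈-++⁺ʳ (map (y ∷_) (nonemptySublists ys)) (∈-nonemptySublists p))
∈-nonemptySublists {xs = []}    (refl ∷ p) = here refl
∈-nonemptySublists {xs = _ ∷ _} (refl ∷ p) =
  there (∈-++⁺ˡ (∈-map⁺ (_ ∷_) (∈-nonemptySublists p)))

∈-coalitions : ∀ {n} (C : Coalition n) → C ∈ˡ coalitions n
∈-coalitions []          = here refl
∈-coalitions (true ∷ C)  = ∈-++⁺ˡ (∈-map⁺ (inside ∷_) (∈-coalitions C))
∈-coalitions (false ∷ C) =
  ∈-++⁺ʳ (map (inside ∷_) (coalitions _))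
    (∈-map⁺ (outside ∷_) (∈-coalitions C))

∈⇒⊆⋃ : ∀ {n} {C : Coalition n} {Cs} → C ∈ˡ Cs → C ⊆ ⋃ Cs
∈⇒⊆⋃ {Cs = _ ∷ Cs} (here refl) = p⊆p∪q (⋃ Cs)
∈⇒⊆⋃ {Cs = D ∷ Cs} (there p)   = q⊆p∪q D (⋃ Cs) ∘ ∈⇒⊆⋃ p

∈⋃⁻ : ∀ {n} {a : Agent n} Cs → a ∈ ⋃ Cs → ∃ λ C → C ∈ˡ Cs × a ∈ C
∈⋃⁻ []       a∈ = contradiction a∈ ∉⊥
∈⋃⁻ (C ∷ Cs) a∈ with x∈p∪q⁻ C (⋃ Cs) a∈
... | inj₁ a∈C = C , here refl , a∈C
... | inj₂ a∈⋃ = let D , D∈ , a∈D = ∈⋃⁻ Cs a∈⋃ in D , there D∈ , a∈D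

module _ {n : ℕ} {AP : Set} (γ : GoalAssignment n AP) where

  support-or-trivial : ∀ C → C ∈ˡ support γ ⊎ T (isTrivial (γ C))
  support-or-trivial C with isTrivial (γ C) in eq
  ... | true  = inj₂ tt
  ... | false = inj₁ (∈-filter⁺ (λ _ → T? _) (∈-coalitions C)
                        (Equivalence.from T-not-≡ eq))

  -- The member `C` makes `Cs` non-empty, as `ΔSupport` collects only unions of non-empty
  -- subfamilies.
  ⋃-∈-ΔSupport : ∀ {C Cs} → C ∈ˡ Cs → Cs Sublist.⊆ support γ →
                 ⋃ Cs ∈ˡ ΔSupport γ
  ⋃-∈-ΔSupport {Cs = _ ∷ _} _ Cs⊆ = ∈-map⁺ ⋃ (∈-nonemptySublists Cs⊆)

module Semantics (em : ExcludedMiddle 0ℓ)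
                 {n : ℕ} {AP : Set} (M : ConcurrentGameModel n AP) where
  open ConcurrentGameModel M
  open GameForm using (act-nonempty)
  open DecMembership (_≟ᶜ_ {n}) using (_∈?_)

  -- Truth of finite connectives and trivial goals

  infix 4 _⊨_ _⊨ᵖ_

  _⊨_ : State → StateFormula n AP → Set
  _⊨_ = _⊩_ M

  _⊨ᵖ_ : Path → PathFormula n AP → Set
  _⊨ᵖ_ = _⊩ᵖ_ M

  Enforces : StrategyProfile → State → GoalAssignment n AP → Set
  Enforces Σ s γ = ∀ C π → paths s Σ C π → π ⊨ᵖ γ C

  ⊨ᵖ-resp-≗ : ∀ θ {π π′} → π ≗ π′ → π ⊨ᵖ θ → π′ ⊨ᵖ θ
  ⊨ᵖ-resp-≗ (X φ)   eq p = subst (_⊨ φ) (eq 1) p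
  ⊨ᵖ-resp-≗ (α U β) eq (i , b , a) =
    i , subst (_⊨ β) (eq i) b , λ j j<i → subst (_⊨ α) (eq j) (a j j<i)
  ⊨ᵖ-resp-≗ (G χ)   eq p i = subst (_⊨ χ) (eq i) (p i)

  ⋀⁺ : ∀ {s φs} → All (s ⊨_) φs → s ⊨ ⋀ φs
  ⋀⁺ []           = tt
  ⋀⁺ (p ∷ [])     = p
  ⋀⁺ (p ∷ q ∷ ps) = p , ⋀⁺ (q ∷ ps)

  ⋀⁻ : ∀ {s} φs → s ⊨ ⋀ φs → All (s ⊨_) φs
  ⋀⁻ []           _        = []
  ⋀⁻ (φ ∷ [])     p        = p ∷ []
  ⋀⁻ (φ ∷ ψ ∷ φs) (p , ps) = p ∷ ⋀⁻ (ψ ∷ φs) ps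

  ⋁⁺ : ∀ {s φs} → Any (s ⊨_) φs → s ⊨ ⋁ φs
  ⋁⁺ {φs = _ ∷ []}    (here p)  = p
  ⋁⁺ {φs = _ ∷ _ ∷ _} (here p)  = inj₁ p
  ⋁⁺ {φs = _ ∷ _ ∷ _} (there p) = inj₂ (⋁⁺ p)

  ⋁⁻ : ∀ {s} φs → s ⊨ ⋁ φs → Any (s ⊨_) φs
  ⋁⁻ []           p        = contradiction tt p
  ⋁⁻ (φ ∷ [])     p        = here p
  ⋁⁻ (φ ∷ ψ ∷ φs) (inj₁ p) = here p
  ⋁⁻ (φ ∷ ψ ∷ φs) (inj₂ p) = there (⋁⁻ (ψ ∷ φs) p)

  someProfile : StrategyProfile
  someProfile a {w} _ =
    let x , p = act-nonempty (𝔤 w) a in x Refinement., Irrelevant.[ p ]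

  mutual
    -- Triviality nests: `is⊤` also accepts a strategic formula all of whose goals are trivial, and
    -- any profile enforces those.
    is⊤-sound : ∀ φ → T (is⊤ φ) → ∀ s → s ⊨ φ
    is⊤-sound ⊤′       _ s = tt
    is⊤-sound ⟨[ γ ]⟩  t s = someProfile , λ C π _ →
      isTrivial-sound (γ C)
        (All.lookup (All.all⁺ _ (coalitions n) t) (∈-coalitions C)) π

    isTrivial-sound : ∀ θ → T (isTrivial θ) → ∀ π → π ⊨ᵖ θ
    isTrivial-sound (X φ) t π = is⊤-sound φ t (π 1)

  enforces-on-support : ∀ {Σ s} γ →
    (∀ C → C ∈ˡ support γ → ∀ π → paths s Σ C π → π ⊨ᵖ γ C) → Enforces Σ s γ
  enforces-on-support γ enf C π π∈ with support-or-trivial γ C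
  ... | inj₁ C∈ = enf C C∈ π π∈
  ... | inj₂ t  = isTrivial-sound (γ C) t π

  ⟨[]⟩-mono : ∀ γ δ → (∀ C π → π ⊨ᵖ γ C → π ⊨ᵖ δ C) →
              ∀ {s} → s ⊨ ⟨[ γ ]⟩ → s ⊨ ⟨[ δ ]⟩
  ⟨[]⟩-mono γ δ γ⇒δ (Σ , enf) = Σ , λ C π π∈ → γ⇒δ C π (enf C π π∈)

  -- Fixpoint laws of single path formulas

  module _ {π : Path} where

    -- If the right-hand side of a U-goal fails now, its witness index is positive and drops by one
    -- on the tail. Next-goals are spent and become trivial.
    later : ∀ θ → (∀ {β} → untilRight θ ≡ just β → ¬ π 0 ⊨ β) →
            π ⊨ᵖ θ → π ∘ suc ⊨ᵖ onlyUG θ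
    later (X φ)   _  _ = tt
    later (α U β) ¬β (zero  , b , _) = contradiction b (¬β refl)
    later (α U β) ¬β (suc i , b , a) = i , b , λ j j<i → a (suc j) (s<s j<i)
    later (G χ)   _  p = p ∘ suc

    until-now : ∀ θ {α} → untilLeft θ ≡ just α →
                (∀ {β} → untilRight θ ≡ just β → ¬ π 0 ⊨ β) →
                π ⊨ᵖ θ → π 0 ⊨ α
    until-now (α U β) refl ¬β (zero  , b , _) = contradiction b (¬β refl)
    until-now (α U β) refl ¬β (suc i , _ , a) = a 0 z<s

    globally-now : ∀ θ {χ} → globallyArg θ ≡ just χ → π ⊨ᵖ θ → π 0 ⊨ χ
    globally-now (G χ) refl p = p 0

    now-and-later : ∀ θ →
      (∀ {φ} → nextArg θ ≡ just φ → π 1 ⊨ φ) →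
      (∀ {α} → untilLeft θ ≡ just α → π 0 ⊨ α) →
      (∀ {χ} → globallyArg θ ≡ just χ → π 0 ⊨ χ) →
      π ∘ suc ⊨ᵖ onlyUG θ → π ⊨ᵖ θ
    now-and-later (X φ)   x _ _ _ = x refl
    now-and-later (α U β) _ u _ (i , b , a) =
      suc i , b , λ { zero _ → u refl ; (suc j) (s<s j<i) → a j j<i }
    now-and-later (G χ)   _ _ g p zero    = g refl
    now-and-later (G χ)   _ _ g p (suc i) = p i

    until-finished : ∀ θ {β} → untilRight θ ≡ just β → π 0 ⊨ β → π ⊨ᵖ θ
    until-finished (α U β) refl b = 0 , b , λ _ ()

  -- Modified goal assignments

  ∖⁺ : ∀ γ C {C′ π} → π ⊨ᵖ γ C′ → π ⊨ᵖ (γ ∖ C) C′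
  ∖⁺ γ C {C′} p with does (C′ ≟ᶜ C)
  ... | true  = tt
  ... | false = p

  ∖⁻ : ∀ γ {C C′ π} → C′ ≢ C → π ⊨ᵖ (γ ∖ C) C′ → π ⊨ᵖ γ C′
  ∖⁻ γ {C} {C′} C′≢C p rewrite dec-false (C′ ≟ᶜ C) C′≢C = p

  ∣UG⁺ : ∀ γ C {C′ π} → (C′ ⊆ C → π ⊨ᵖ onlyUG (γ C′)) →
         π ⊨ᵖ (γ ∣ C ∣UG) C′
  ∣UG⁺ γ C {C′} p with C′ ⊆? C
  ... | yes C′⊆C = p C′⊆C
  ... | no  _    = tt

  ∣UG⁻ : ∀ γ {C C′ π} → C′ ⊆ C → π ⊨ᵖ (γ ∣ C ∣UG) C′ → π ⊨ᵖ onlyUG (γ C′)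
  ∣UG⁻ γ {C} {C′} C′⊆C p rewrite dec-true (C′ ⊆? C) C′⊆C = p

  NextGoals : GoalAssignment n AP → Coalition n → State → Set
  NextGoals γ C w =
    ∀ {C′ φ} → C′ ∈ˡ support γ → C′ ⊆ C → nextArg (γ C′) ≡ just φ → w ⊨ φ

  Δ⁺ : ∀ γ C {π} →
    (C ∈ˡ ΔSupport γ → NextGoals γ C (π 1) × π 1 ⊨ ⟨[ γ ∣ C ∣UG ]⟩) →
    π ⊨ᵖ Δ γ C
  Δ⁺ γ C {π} p with C ∈? ΔSupport γ
  ... | no  _  = tt
  ... | yes C∈ = ⋀⁺ (All.++⁺ (All.tabulate next) (proj₂ (p C∈) ∷ []))
    where
    next : ∀ {φ} → φ ∈ˡ mapMaybe (nextArg ∘ γ) (filter (_⊆? C) (support γ)) →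
           π 1 ⊨ φ
    next φ∈ with ∈-mapMaybe⁻ (nextArg ∘ γ) (filter (_⊆? C) (support γ)) φ∈
    ... | C′ , C′∈ , eq =
      let C′∈supp , C′⊆C = ∈-filter⁻ (_⊆? C) {xs = support γ} C′∈
      in proj₁ (p C∈) C′∈supp C′⊆C eq

  Δ⁻ : ∀ γ {C π} → C ∈ˡ ΔSupport γ → π ⊨ᵖ Δ γ C →
    NextGoals γ C (π 1) × π 1 ⊨ ⟨[ γ ∣ C ∣UG ]⟩
  Δ⁻ γ {C} C∈ p rewrite dec-true (C ∈? ΔSupport γ) C∈ =
    let ps , q = All.++⁻ (mapMaybe (nextArg ∘ γ) (filter (_⊆? C) (support γ)))
                   (⋀⁻ _ p)
    in (λ C′∈ C′⊆C eq → All.lookup ps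
          (∈-mapMaybe⁺ (nextArg ∘ γ) (∈-filter⁺ (_⊆? C) C′∈ C′⊆C) eq))
     , All.singleton⁻ q

  -- Histories and strategy profiles

  -- Total, since a history need not respect `out`: nothing ties `out s ζ` to the first state of the
  -- given history.
  prepend : ∀ s → ActionProfile s → ∀ {v} → History v → History v
  prepend s ζ ⟨ w ⟩      = ⟨ s ⟩ ▹ ζ , w
  prepend s ζ (h ▹ ξ , w) = prepend s ζ h ▹ ξ , w

  uncons : ∀ {v} → History v → Maybe (∃ λ s → ActionProfile s × History v)
  uncons ⟨ _ ⟩ = nothing
  uncons (_▹_,_ {v} h ξ w) =
    -- If `uncons h` is `nothing`, then `h` is `⟨ v ⟩` and `ξ` is itself the first round.
    just (maybe′ (λ (s , ζ , t) → s , ζ , (t ▹ ξ , w)) (v , ξ , ⟨ w ⟩) (uncons h))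

  uncons-prepend : ∀ s ζ {v} (h : History v) →
                   uncons (prepend s ζ h) ≡ just (s , ζ , h)
  uncons-prepend s ζ ⟨ w ⟩ = refl
  uncons-prepend s ζ (h ▹ ξ , w) rewrite uncons-prepend s ζ h = refl

  prepend-injective : ∀ {s ζ v} {h h′ : History v} →
                      prepend s ζ h ≡ prepend s ζ h′ → h ≡ h′
  prepend-injective {s} {ζ} {h = h} {h′} eq
    with refl ← just-injective (trans (sym (uncons-prepend s ζ h))
                  (trans (cong uncons eq) (uncons-prepend s ζ h′))) = refl

  -- Stated for pairs because a history and `⟨ s ⟩` may have different end states, hence different
  -- types.
  IsRoot : State → ∃ History → Set
  IsRoot s h = h ≡ (s , ⟨ s ⟩)

  prepend-not-root : ∀ {s u ζ v} (h : History v) →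
                     ¬ IsRoot s (v , prepend u ζ h)
  prepend-not-root ⟨ _ ⟩ ()
  prepend-not-root (h ▹ ξ , w) ()

  shift : ∀ s → ActionProfile s → StrategyProfile → StrategyProfile
  shift s ζ Σ a h = Σ a (prepend s ζ h)

  -- Induction on the index: `step` depends only on the current history and the action profile
  -- chosen there. It serves both to cut off a first round and to add one.
  play-suc : ∀ Σ Σ′ s ζ → actions Σ ⟨ s ⟩ ≡ ζ →
    (∀ {v} (h : History v) → actions Σ (prepend s ζ h) ≡ actions Σ′ h) →
    ∀ i → let v , h = play Σ′ (out s ζ) i in
    play Σ s (suc i) ≡ (v , prepend s ζ h)
  play-suc Σ Σ′ s ζ root tail zero =
    cong (λ ξ → out s ξ , (⟨ s ⟩ ▹ ξ , out s ξ)) root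
  play-suc Σ Σ′ s ζ root tail (suc i) =
    let v , h = play Σ′ (out s ζ) i in
    trans (cong (step Σ) (play-suc Σ Σ′ s ζ root tail i))
          (cong (λ ξ → out v ξ , (prepend s ζ h ▹ ξ , out v ξ)) (tail h))

  inducedPath-shift : ∀ Σ s → let ζ = actions Σ ⟨ s ⟩ in
    inducedPath Σ s ∘ suc ≗ inducedPath (shift s ζ Σ) (out s ζ)
  inducedPath-shift Σ s i =
    cong proj₁ (play-suc Σ (shift s _ Σ) s _ refl (λ _ → refl) i)

  -- Actions are chosen for all agents at once, so that the profile played at a
  -- history is literally ζ or actions Σ′ t: pointwise equality of action
  -- profiles would not determine the outcome without function extensionality.
  module _ (s : State) (ζ : ActionProfile s) (Σ Σ′ : StrategyProfile) where

    deviateActions : ∀ {v} → History v → ActionProfile v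
    deviateActions {v} h with em {IsRoot s (v , h)}
    ... | yes refl = ζ
    ... | no  _    with em {∃ λ t → prepend s ζ t ≡ h}
    ...   | yes (t , _) = actions Σ′ t
    ...   | no  _       = actions Σ h

    deviate : StrategyProfile
    deviate a h = deviateActions h a

    deviate-root : actions deviate ⟨ s ⟩ ≡ ζ
    deviate-root with em {IsRoot s (s , ⟨ s ⟩)}
    ... | yes refl = refl
    ... | no  ¬eq  = contradiction refl ¬eq

    deviate-prepend : ∀ {v} (h : History v) →
      actions deviate (prepend s ζ h) ≡ actions Σ′ h
    deviate-prepend {v} h with em {IsRoot s (v , prepend s ζ h)}
    ... | yes eq = contradiction eq (prepend-not-root h)
    ... | no  _  with em {∃ λ t → prepend s ζ t ≡ prepend s ζ h}
    -- The preimage supplied by `em` is an arbitrary one; injectivity identifies it with `h`.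
    ...   | yes (t , eq) = cong (actions Σ′) (prepend-injective eq)
    ...   | no  ¬∃       = contradiction (h , refl) ¬∃

    -- Three cases: the root, the histories that begin with `s ζ`, and all others, where `deviate`
    -- copies `Σ`. This is what turns a play against the shifted profile into one against `Σ`.
    deviate-agrees : ∀ C → (∀ a → a ∈ C → ζ a ≡ Σ a ⟨ s ⟩) →
      AgreeOn C Σ′ (shift s ζ Σ) → AgreeOn C deviate Σ
    deviate-agrees C root tail a a∈C {v} h
      with em {IsRoot s (v , h)}
    ... | yes refl = root a a∈C
    ... | no  _    with em {∃ λ t → prepend s ζ t ≡ h}
    ...   | yes (t , refl) = tail a a∈C t
    ...   | no  _          = refl

    inducedPath-deviate :
      inducedPath deviate s ∘ suc ≗ inducedPath Σ′ (out s ζ)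
    inducedPath-deviate i =
      cong proj₁ (play-suc deviate Σ′ s ζ deviate-root deviate-prepend i)

  -- Whereas `deviate` fixes one first round, the continuation here reacts to whichever first round
  -- was played.
  splice : StrategyProfile → (∀ s → ActionProfile s → StrategyProfile) →
           StrategyProfile
  splice Σ k a h = maybe′ (λ (s , ζ , t) → k s ζ a t) (Σ a h) (uncons h)

  splice-prepend : ∀ Σ k a s ζ {v} (h : History v) →
                   splice Σ k a (prepend s ζ h) ≡ k s ζ a h
  splice-prepend Σ k a s ζ h rewrite uncons-prepend s ζ h = refl

  -- Unfolding

  Finishes : GoalAssignment n AP → State → Set
  Finishes γ s =
    ∃ λ C → ∃ λ β → untilRight (γ C) ≡ just β × s ⊨ β × s ⊨ ⟨[ γ ∖ C ]⟩

  HoldsNow : GoalAssignment n AP → State → Set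
  HoldsNow γ s = (∀ C {α} → untilLeft (γ C) ≡ just α → s ⊨ α)
               × (∀ C {χ} → globallyArg (γ C) ≡ just χ → s ⊨ χ)

  -- `δ` is left arbitrary so that one translation serves both `unfold` and `ind`.
  finish-or-continue⁺ : ∀ γ δ {s} →
    Finishes γ s ⊎ HoldsNow γ s × s ⊨ ⟨[ δ ]⟩ →
    s ⊨ ⋁ (Finish γ ++ [ ⋀ (UHolds γ ++ GHolds γ ++ [ ⟨[ δ ]⟩ ]) ])
  finish-or-continue⁺ γ δ {s} (inj₁ (C , β , eq , b , rest)) =
    ⋁⁺ (Any.++⁺ˡ (Membership.lose
      (∈-mapMaybe⁺ _ (∈-coalitions C) (cong (Maybe.map _) eq))
      (b , rest)))
  finish-or-continue⁺ γ δ {s} (inj₂ ((u , g) , d)) =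
    ⋁⁺ (Any.++⁺ʳ (Finish γ) (here (⋀⁺
      (All.++⁺ (All.tabulate u′) (All.++⁺ (All.tabulate g′) (d ∷ []))))))
    where
    u′ : ∀ {α} → α ∈ˡ UHolds γ → s ⊨ α
    u′ α∈ = let C , _ , eq = ∈-mapMaybe⁻ _ (coalitions n) α∈ in u C eq

    g′ : ∀ {χ} → χ ∈ˡ GHolds γ → s ⊨ χ
    g′ χ∈ = let C , _ , eq = ∈-mapMaybe⁻ _ (coalitions n) χ∈ in g C eq

  finish-or-continue⁻ : ∀ γ δ {s} →
    s ⊨ ⋁ (Finish γ ++ [ ⋀ (UHolds γ ++ GHolds γ ++ [ ⟨[ δ ]⟩ ]) ]) →
    Finishes γ s ⊎ HoldsNow γ s × s ⊨ ⟨[ δ ]⟩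
  finish-or-continue⁻ γ δ {s} p with Any.++⁻ (Finish γ) (⋁⁻ _ p)
  ... | inj₂ q =
    let us , gs++d = All.++⁻ (UHolds γ) (⋀⁻ _ (Any.singleton⁻ q))
        gs , d     = All.++⁻ (GHolds γ) gs++d
    in inj₂ ( ( (λ C eq → All.lookup us (∈-mapMaybe⁺ _ (∈-coalitions C) eq))
              , (λ C eq → All.lookup gs (∈-mapMaybe⁺ _ (∈-coalitions C) eq)))
            , All.singleton⁻ d)
  ... | inj₁ q with Membership.find q
  ...   | ψ , ψ∈ , sψ with ∈-mapMaybe⁻ _ (coalitions n) ψ∈
  ...     | C , _ , eq with untilRight (γ C) in eqC | eq
  ...       | just β | refl = inj₁ (C , β , eqC , sψ)

  module _ (γ : GoalAssignment n AP) {s : State} where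

    ⟨[]⟩⇒finish-or-continue :
      s ⊨ ⟨[ γ ]⟩ → Finishes γ s ⊎ HoldsNow γ s × s ⊨ ⟨[ Δ γ ]⟩
    ⟨[]⟩⇒finish-or-continue (Σ , enf)
      with em {∃ λ C → ∃ λ β → untilRight (γ C) ≡ just β × s ⊨ β}
    ... | yes (C , β , eq , b) =
      inj₁ (C , β , eq , b , Σ , λ C′ π π∈ → ∖⁺ γ C (enf C′ π π∈))
    ... | no ¬fin =
      inj₂ ( ( (λ C eq → until-now (γ C) eq (¬β C) (here-enf C))
             , (λ C eq → globally-now (γ C) eq (here-enf C)))
           , Σ , enf-Δ)
      where
      ¬β : ∀ C {β} → untilRight (γ C) ≡ just β → ¬ s ⊨ β
      ¬β C eq b = ¬fin (C , _ , eq , b)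

      -- The play of `Σ` itself is a path for every coalition, so it shows what holds at `s`.
      here-enf : ∀ C → inducedPath Σ s ⊨ᵖ γ C
      here-enf C = enf C _ (Σ , (λ _ _ _ → refl) , λ _ → refl)

      enf-Δ : Enforces Σ s (Δ γ)
      enf-Δ C π (Σ′ , agree , π≗) = Δ⁺ γ C λ _ →
          next
        , subst (_⊨ ⟨[ γ ∣ C ∣UG ]⟩) (sym (π≗ 1)) (shift s ζ Σ , enf-rest)
        where
        -- The first round is read off from the given path, so the profile offered at the next state
        -- may depend on it.
        ζ : ActionProfile s
        ζ = actions Σ′ ⟨ s ⟩

        next : NextGoals γ C (π 1)
        next {C′} _ C′⊆C eq
          with γ C′ | enf C′ π (Σ′ , (λ a → agree a ∘ C′⊆C) , π≗)
        next _ C′⊆C refl | X φ | p = p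

        enf-rest : Enforces (shift s ζ Σ) (out s ζ) (γ ∣ C ∣UG)
        enf-rest C′ π′ (Σ″ , agree″ , π′≗) = ∣UG⁺ γ C λ C′⊆C →
          ⊨ᵖ-resp-≗ (onlyUG (γ C′))
            (λ i → trans (inducedPath-deviate s ζ Σ Σ″ i) (sym (π′≗ i)))
            (later (γ C′) (¬β C′) (enf C′ _
              ( deviate s ζ Σ Σ″
              , deviate-agrees s ζ Σ Σ″ C′
                  (λ a a∈ → agree a (C′⊆C a∈) ⟨ s ⟩) agree″
              , λ _ → refl)))

    -- The profile for the remaining goals suffices: the goal of `C` is met at index 0 of every path
    -- from `s`.
    finishes⇒⟨[]⟩ : Finishes γ s → s ⊨ ⟨[ γ ]⟩
    finishes⇒⟨[]⟩ (C , β , eq , b , Σ , enf) = Σ , enf′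
      where
      enf′ : Enforces Σ s γ
      enf′ C′ π π∈ with C′ ≟ᶜ C
      ... | no C′≢C  = ∖⁻ γ C′≢C (enf C′ π π∈)
      ... | yes refl =
        until-finished (γ C) eq (subst (_⊨ β) (sym (proj₂ (proj₂ π∈) 0)) b)

    continues⇒⟨[]⟩ : HoldsNow γ s → s ⊨ ⟨[ Δ γ ]⟩ → s ⊨ ⟨[ γ ]⟩
    continues⇒⟨[]⟩ (u , g) (Σ , enf) =
      splice Σ continuation , enforces-on-support γ enf-γ
      where
      Follows : ∀ v → ActionProfile v → Coalition n → Set
      Follows v ζ C = ∀ a → a ∈ C → ζ a ≡ Σ a ⟨ v ⟩

      followers : ∀ v → ActionProfile v → List (Coalition n)
      followers v ζ = filter (λ C → em {Follows v ζ C}) (support γ)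

      -- The continuation sees only `ζ`, not which coalition will keep following, so it must serve
      -- all possible followers at once.
      remaining : ∀ v → ActionProfile v → GoalAssignment n AP
      remaining v ζ = γ ∣ ⋃ (followers v ζ) ∣UG

      continuation : ∀ v → ActionProfile v → StrategyProfile
      continuation v ζ with em {out v ζ ⊨ ⟨[ remaining v ζ ]⟩}
      ... | yes (Σ′ , _) = Σ′
      -- A default value; `enf-γ` shows that no first round at `s` followed by a coalition of the
      -- support leads here.
      ... | no  _        = Σ

      continuation-enforces : ∀ v ζ → out v ζ ⊨ ⟨[ remaining v ζ ]⟩ →
        Enforces (continuation v ζ) (out v ζ) (remaining v ζ)
      continuation-enforces v ζ p with em {out v ζ ⊨ ⟨[ remaining v ζ ]⟩}
      ... | yes (_ , q) = q
      ... | no  ¬p      = contradiction p ¬p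

      enf-γ : ∀ C → C ∈ˡ support γ →
        ∀ π → paths s (splice Σ continuation) C π → π ⊨ᵖ γ C
      enf-γ C C∈ π (Σ′ , agree , π≗) = now-and-later (γ C)
          (λ eq → proj₁ next C∈ C⊆D eq)
          (λ {α} eq → subst (_⊨ α) (sym (π≗ 0)) (u C eq))
          (λ {χ} eq → subst (_⊨ χ) (sym (π≗ 0)) (g C eq))
          -- After the first round, `splice` plays `continuation s ζ`, so the tail of `π` is a path
          -- for `C` against that profile.
          (∣UG⁻ γ C⊆D (continuation-enforces s ζ
            (subst (_⊨ ⟨[ remaining s ζ ]⟩) (π≗ 1) (proj₂ next)) C (π ∘ suc)
            ( shift s ζ Σ′
            , (λ a a∈C h → trans (agree a a∈C (prepend s ζ h))
                                 (splice-prepend Σ continuation a s ζ h))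
            , λ i → trans (π≗ (suc i)) (inducedPath-shift Σ′ s i))))
        where
        ζ : ActionProfile s
        ζ = actions Σ′ ⟨ s ⟩

        D : Coalition n
        D = ⋃ (followers s ζ)

        -- At the root `splice` falls back on `Σ`, so agreement there is exactly `Follows`.
        C∈followers : C ∈ˡ followers s ζ
        C∈followers = ∈-filter⁺ _ C∈ (λ a a∈C → agree a a∈C ⟨ s ⟩)

        C⊆D : C ⊆ D
        C⊆D = ∈⇒⊆⋃ C∈followers

        D-follows : Follows s ζ D
        D-follows a a∈D =
          let _ , C′∈ , a∈C′ = ∈⋃⁻ (followers s ζ) a∈D
          in proj₂ (∈-filter⁻ (λ C → em {Follows s ζ C}) {xs = support γ} C′∈)
               a a∈C′

        -- `Σ′` agrees with the spliced profile, not with `Σ`, so `enf` says nothing about `π`. `Σ″`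
        -- plays `ζ` and then returns to `Σ`; it reaches the same state at index 1, the only one
        -- that the next-goal of `D` concerns.
        Σ″ : StrategyProfile
        Σ″ = deviate s ζ Σ (shift s ζ Σ)

        π≡Σ″ : π 1 ≡ inducedPath Σ″ s 1
        π≡Σ″ = trans (π≗ 1) (sym (inducedPath-deviate s ζ Σ (shift s ζ Σ) 0))

        next : NextGoals γ D (π 1) × π 1 ⊨ ⟨[ γ ∣ D ∣UG ]⟩
        next = subst (λ w → NextGoals γ D w × w ⊨ ⟨[ γ ∣ D ∣UG ]⟩) (sym π≡Σ″)
          (Δ⁻ γ (⋃-∈-ΔSupport γ C∈followers (filter-⊆ _ (support γ)))
            (enf D (inducedPath Σ″ s)
              ( Σ″
              , deviate-agrees s ζ Σ (shift s ζ Σ) D D-follows (λ _ _ _ → refl)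
              , λ _ → refl)))

    ⟨[]⟩⇔unfold : s ⊨ ⟨[ γ ]⟩ ⇔ s ⊨ unfold γ
    ⟨[]⟩⇔unfold = mk⇔
      (finish-or-continue⁺ γ (Δ γ) ∘ ⟨[]⟩⇒finish-or-continue)
      (Sum.[ finishes⇒⟨[]⟩ , (λ (now , d) → continues⇒⟨[]⟩ now d) ]
        ∘ finish-or-continue⁻ γ (Δ γ))

  -- Long-term temporal goal assignments

  module _ (γ : GoalAssignment n AP) (ltt : LongTermTemporal γ) where

    onlyUG≡ : ∀ {C} → C ∈ˡ support γ → onlyUG (γ C) ≡ γ C
    onlyUG≡ {C} C∈ with γ C | ltt C C∈
    ... | _ | isU = refl
    ... | _ | isG = refl

    no-next : ∀ {C φ} → C ∈ˡ support γ → nextArg (γ C) ≢ just φ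
    no-next {C} C∈ eq with γ C | ltt C C∈
    no-next {C} C∈ () | _ | isU
    no-next {C} C∈ () | _ | isG

    -- Every coalition of the support lies in the union, and its goal is unchanged by `onlyUG`.
    restrict⇒⟨[]⟩ : ∀ {s} → s ⊨ ⟨[ γ ∣ ⋃ (support γ) ∣UG ]⟩ → s ⊨ ⟨[ γ ]⟩
    restrict⇒⟨[]⟩ (Σ , enf) = Σ , enforces-on-support γ λ C C∈ π π∈ →
      subst (π ⊨ᵖ_) (onlyUG≡ C∈) (∣UG⁻ γ (∈⇒⊆⋃ C∈) (enf C π π∈))

    ⟨[]⟩⇒restrict : ∀ {s} → s ⊨ ⟨[ γ ]⟩ → s ⊨ ⟨[ γ ∣ ⋃ (support γ) ∣UG ]⟩
    ⟨[]⟩⇒restrict (Σ , enf) = Σ , λ C π π∈ →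
      ∣UG⁺ γ (⋃ (support γ)) (λ _ → onlyUG⁺ (γ C) (enf C π π∈))
      where
      onlyUG⁺ : ∀ θ {π} → π ⊨ᵖ θ → π ⊨ᵖ onlyUG θ
      onlyUG⁺ (X _)   _ = tt
      onlyUG⁺ (_ U _) p = p
      onlyUG⁺ (G _)   p = p

    -- The two assignments differ at most at the union of the support, where the strategic conjunct
    -- of `Δ γ` yields `⟨[ γ ]⟩`.
    Δ⇒ΔInd : ∀ C π → π ⊨ᵖ Δ γ C → π ⊨ᵖ Δ_⟨_⟩ γ ⟨[ γ ]⟩ C
    Δ⇒ΔInd C π p with C ≟ᶜ ⋃ (support γ)
    ... | no  _    = p
    -- If the support is empty, then Δ γ C is trivial and carries no information.
    ... | yes refl with em {∃ λ C → C ∈ˡ support γ}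
    ...   | yes (_ , C∈) =
      restrict⇒⟨[]⟩ (proj₂ (Δ⁻ γ (⋃-∈-ΔSupport γ C∈ Sublist.⊆-refl) p))
    ...   | no ¬∃ =
      someProfile , enforces-on-support γ λ _ C∈ → contradiction (_ , C∈) ¬∃

    ΔInd⇒Δ : ∀ C π → π ⊨ᵖ Δ_⟨_⟩ γ ⟨[ γ ]⟩ C → π ⊨ᵖ Δ γ C
    ΔInd⇒Δ C π p with C ≟ᶜ ⋃ (support γ)
    ... | no  _    = p
    -- No coalition of the support has a next-goal, so only the strategic conjunct carries content.
    ... | yes refl = Δ⁺ γ _ λ _ →
      (λ C∈ _ eq → contradiction eq (no-next C∈)) , ⟨[]⟩⇒restrict p

    unfold⇔ind : ∀ {s} → s ⊨ unfold γ ⇔ s ⊨ ind γ ⟨[ γ ]⟩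
    unfold⇔ind = mk⇔
      (finish-or-continue⁺ γ ΔInd
        ∘ Sum.map₂ (Product.map₂ (⟨[]⟩-mono (Δ γ) ΔInd Δ⇒ΔInd))
        ∘ finish-or-continue⁻ γ (Δ γ))
      (finish-or-continue⁺ γ (Δ γ)
        ∘ Sum.map₂ (Product.map₂ (⟨[]⟩-mono ΔInd (Δ γ) ΔInd⇒Δ))
        ∘ finish-or-continue⁻ γ ΔInd)
      where
      ΔInd : GoalAssignment n AP
      ΔInd = Δ_⟨_⟩ γ ⟨[ γ ]⟩

theorem1 : ExcludedMiddle 0ℓ → (n : ℕ) (AP : Set) →
    ((γ : GoalAssignment n AP) → ⟨[ γ ]⟩ ≣ unfold γ) ×
    ((γ : GoalAssignment n AP) → LongTermTemporal γ → ⟨[ γ ]⟩ ≣ ind γ ⟨[ γ ]⟩)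
theorem1 em n AP =
    (λ γ M s → Semantics.⟨[]⟩⇔unfold em M γ)
  , (λ γ ltt M s → Semantics.unfold⇔ind em M γ ltt
                     ⇔-∘ Semantics.⟨[]⟩⇔unfold em M γ)
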